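{- Let $M\in\mathbb{R}_+^{m\times n}$ be a matrix with nonnegative real entries, and let $r$ be a positive integer. Then the following holds: (i) If there is a one-way quantum protocol with $r$-dimensional messages that computes $M$ in expectation, then $M$ has a rank-$r$ PSD factorization. (ii) If $M$ has a rank-$r$ PSD factorization, then there is a one-way quantum protocol with $(r+1)$-dimensional messages that computes $M$ in expectation.
   Context: All matrices are real; PSD means symmetric positive semidefinite. A rank-$r$ PSD factorization of an $m\times n$ matrix $M$ is a collection of $r\times r$ PSD matrices $T_1,\ldots,T_m$ and $U^1,\ldots,U^n$ such that $\operatorname{Tr}[T_iU^j]=M_{ij}$ for all $i\in\{1,\ldots,m\}$, $j\in\{1,\ldots,n\}$. An $r$-dimensional quantum state is an $r\times r$ PSD matrix $\rho$ of trace $1$. A POVM (in dimension $r$) is a finite family $\{E_\theta\}_{\theta\in\Theta}$ of $r\times r$ PSD matrices, labeled by distinct real numbers $\theta$, with $\sum_{\theta\in\Theta}E_\theta=I$. Measuring state $\rho$ with this POVM yields outcome $\theta$ with probability $\operatorname{Tr}[E_\theta\rho]$, so the expected outcome is $\sum_{\theta\in\Theta}\theta\operatorname{Tr}[E_\theta\rho]$. A one-way quantum protocol with $r$-dimensional messages (for row inputs $i\in\{1,\dots,m\}$ and column inputs $j\in\{1,\dots,n\}$) consists of an $r$-dimensional state $\rho_i$ for each $i$ (sent by Alice on input $i$) and, for each $j$, a POVM $\{E^j_\theta\}$ in dimension $r$ whose labels $\theta$ are all nonnegative (with which Bob, on input $j$, measures the state received, outputting the outcome). The protocol computes $M$ in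 expectation if for all $i,j$ the expected value of the output on inputs $i,j$, namely $\sum_\theta\theta\operatorname{Tr}[E^j_\theta\rho_i]$, equals $M_{ij}$. -}

module Defs where

open import Algebra.Bundles.Raw using (RawMonoid)
open import Data.Bool.Base using (if_then_else_)
open import Data.Fin.Base using (Fin)
open import Data.Fin.Properties using (_≟_)
open import Data.Nat.Base as ℕ using (ℕ)
import Data.Nat.Properties as ℕ
open import Data.Product.Base using (_×_; _,_; ∃-syntax)
open import Data.Rational.Base as ℚ using (ℚ; 0ℚ; 1ℚ; ½)
import Data.Rational.Properties as ℚ
import Data.Rational.Solver as ℚ
open import Data.Vec.Functional using (Vector)
open import Function.Definitions using (Injective)
open import Level using (0ℓ)
open import Relation.Binary.PropositionalEquality
  using (_≡_; refl; sym; trans; cong; subst)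
open import Relation.Nullary.Decidable using (does)

-- A real number is a Cauchy sequence of rationals; two sequences are equal
-- as reals (_≈_ below) when their difference tends to 0.

CloseBeyond : (ℕ → ℚ) → ℚ → Set
CloseBeyond x ε =
  ∃[ N ] (∀ m n → N ℕ.≤ m → N ℕ.≤ n → ℚ.∣ x m ℚ.- x n ∣ ℚ.< ε)

IsCauchy : (ℕ → ℚ) → Set
IsCauchy x = ∀ ε → 0ℚ ℚ.< ε → CloseBeyond x ε

private
  open ℚ.+-*-Solver using (solve; _:=_; _:+_; _:*_; _:-_)

  +-split : ∀ a b c d → (a ℚ.+ b) ℚ.- (c ℚ.+ d) ≡ (a ℚ.- c) ℚ.+ (b ℚ.- d)
  +-split = solve 4
    (λ a b c d → (a :+ b) :- (c :+ d) := (a :- c) :+ (b :- d)) refl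

  *-split : ∀ a b c d →
    (a ℚ.* b) ℚ.- (c ℚ.* d) ≡ a ℚ.* (b ℚ.- d) ℚ.+ d ℚ.* (a ℚ.- c)
  *-split = solve 4
    (λ a b c d → (a :* b) :- (c :* d) := a :* (b :- d) :+ d :* (a :- c)) refl

  shift : ∀ a b → (a ℚ.- b) ℚ.+ b ≡ a
  shift = solve 2 (λ a b → (a :- b) :+ b := a) refl

  half+half : ∀ p → ½ ℚ.* p ℚ.+ ½ ℚ.* p ≡ p
  half+half p = trans (sym (ℚ.*-distribʳ-+ p ½ ½)) (ℚ.*-identityˡ p)

  half-pos : ∀ {ε} → 0ℚ ℚ.< ε → 0ℚ ℚ.< ½ ℚ.* ε
  half-pos {ε} 0<ε = subst (ℚ._< ½ ℚ.* ε) (ℚ.*-zeroʳ ½) (ℚ.*-monoʳ-<-pos ½ 0<ε)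

  <1+∣∣ : ∀ a b → ℚ.∣ a ℚ.- b ∣ ℚ.< 1ℚ → ℚ.∣ a ∣ ℚ.< 1ℚ ℚ.+ ℚ.∣ b ∣
  <1+∣∣ a b a~b = ℚ.≤-<-trans
    (subst (λ z → ℚ.∣ z ∣ ℚ.≤ ℚ.∣ a ℚ.- b ∣ ℚ.+ ℚ.∣ b ∣) (shift a b)
      (ℚ.∣p+q∣≤∣p∣+∣q∣ (a ℚ.- b) b))
    (ℚ.+-monoˡ-< ℚ.∣ b ∣ a~b)

  1+∣∣-pos : ∀ q → ℚ.Positive (1ℚ ℚ.+ ℚ.∣ q ∣)
  1+∣∣-pos q = ℚ.pos+nonNeg⇒pos 1ℚ ℚ.∣ q ∣ {{ℚ.∣-∣-nonNeg q}}

  ∣*∣-bound : ∀ {a b B δ} → .{{ℚ.Positive B}} →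
    ℚ.∣ a ∣ ℚ.< B → ℚ.∣ b ∣ ℚ.< δ → ℚ.∣ a ℚ.* b ∣ ℚ.< B ℚ.* δ
  ∣*∣-bound {a} {b} {B} {δ} a<B b<δ = begin-strict
    ℚ.∣ a ℚ.* b ∣        ≡⟨ ℚ.∣p*q∣≡∣p∣*∣q∣ a b ⟩
    ℚ.∣ a ∣ ℚ.* ℚ.∣ b ∣  ≤⟨ ℚ.*-monoʳ-≤-nonNeg ℚ.∣ b ∣ {{ℚ.∣-∣-nonNeg b}} (ℚ.<⇒≤ a<B) ⟩
    B ℚ.* ℚ.∣ b ∣        <⟨ ℚ.*-monoʳ-<-pos B b<δ ⟩
    B ℚ.* δ              ∎
    where open ℚ.≤-Reasoning

  *-close : ∀ a b c d {B C δ ε} → .{{ℚ.Positive B}} → .{{ℚ.Positive C}} →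
    ℚ.∣ a ∣ ℚ.< B → ℚ.∣ d ∣ ℚ.< C →
    ℚ.∣ a ℚ.- c ∣ ℚ.< δ → ℚ.∣ b ℚ.- d ∣ ℚ.< δ →
    B ℚ.* δ ℚ.+ C ℚ.* δ ≡ ε → ℚ.∣ (a ℚ.* b) ℚ.- (c ℚ.* d) ∣ ℚ.< ε
  *-close a b c d {B} {C} {δ} {ε} a<B d<C a~c b~d Bδ+Cδ≡ε = begin-strict
    ℚ.∣ (a ℚ.* b) ℚ.- (c ℚ.* d) ∣
      ≡⟨ cong ℚ.∣_∣ (*-split a b c d) ⟩
    ℚ.∣ a ℚ.* (b ℚ.- d) ℚ.+ d ℚ.* (a ℚ.- c) ∣
      ≤⟨ ℚ.∣p+q∣≤∣p∣+∣q∣ (a ℚ.* (b ℚ.- d)) (d ℚ.* (a ℚ.- c)) ⟩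
    ℚ.∣ a ℚ.* (b ℚ.- d) ∣ ℚ.+ ℚ.∣ d ℚ.* (a ℚ.- c) ∣
      <⟨ ℚ.+-mono-< (∣*∣-bound a<B b~d) (∣*∣-bound d<C a~c) ⟩
    B ℚ.* δ ℚ.+ C ℚ.* δ
      ≡⟨ Bδ+Cδ≡ε ⟩
    ε ∎
    where open ℚ.≤-Reasoning

  common-tolerance : ∀ B C {ε} → .{{ℚ.Positive B}} → .{{ℚ.Positive C}} → 0ℚ ℚ.< ε →
    ∃[ δ ] (0ℚ ℚ.< δ × B ℚ.* δ ℚ.+ C ℚ.* δ ≡ ε)
  common-tolerance B C {ε} 0<ε = δ , 0<δ , (begin-equality
    B ℚ.* δ ℚ.+ C ℚ.* δ    ≡⟨ ℚ.*-distribʳ-+ δ B C ⟨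
    D ℚ.* ((ℚ.1/ D) ℚ.* ε) ≡⟨ ℚ.*-assoc D (ℚ.1/ D) ε ⟨
    (D ℚ.* (ℚ.1/ D)) ℚ.* ε ≡⟨ cong (ℚ._* ε) (ℚ.*-inverseʳ D) ⟩
    1ℚ ℚ.* ε               ≡⟨ ℚ.*-identityˡ ε ⟩
    ε                      ∎)
    where
    open ℚ.≤-Reasoning

    D δ : ℚ
    D = B ℚ.+ C

    instance
      D-pos : ℚ.Positive D
      D-pos = ℚ.pos+pos⇒pos B C

      D-nonZero : ℚ.NonZero D
      D-nonZero = ℚ.pos⇒nonZero D

    δ = (ℚ.1/ D) ℚ.* ε

    0<δ : 0ℚ ℚ.< δ
    0<δ = subst (ℚ._< δ) (ℚ.*-zeroʳ (ℚ.1/ D))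
      (ℚ.*-monoʳ-<-pos (ℚ.1/ D) {{ℚ.1/pos⇒pos D}} 0<ε)

  Bounded : (ℕ → ℚ) → Set
  Bounded x = ∃[ B ] (ℚ.Positive B × ∃[ N ] (∀ n → N ℕ.≤ n → ℚ.∣ x n ∣ ℚ.< B))

  Cauchy-bound : ∀ {x} → IsCauchy x → Bounded x
  Cauchy-bound {x} x-cauchy with N , x-close ← x-cauchy 1ℚ (ℚ.positive⁻¹ 1ℚ)
    = 1ℚ ℚ.+ ℚ.∣ x N ∣ , 1+∣∣-pos (x N) , N
    , λ n n≥N → <1+∣∣ (x n) (x N) (x-close n N n≥N ℕ.≤-refl)

  -- Opaque so that comparing reals never unfolds these proofs.
  abstract
    +-cauchy : ∀ x y → IsCauchy x → IsCauchy y → IsCauchy (λ n → x n ℚ.+ y n)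
    +-cauchy x y x-cauchy y-cauchy ε 0<ε =
      close (x-cauchy (½ ℚ.* ε) (half-pos 0<ε)) (y-cauchy (½ ℚ.* ε) (half-pos 0<ε))
      where
      close : CloseBeyond x (½ ℚ.* ε) → CloseBeyond y (½ ℚ.* ε) →
        CloseBeyond (λ n → x n ℚ.+ y n) ε
      close (N , x-close) (K , y-close) = N ℕ.⊔ K , λ m n m≥ n≥ → begin-strict
        ℚ.∣ (x m ℚ.+ y m) ℚ.- (x n ℚ.+ y n) ∣
          ≡⟨ cong ℚ.∣_∣ (+-split (x m) (y m) (x n) (y n)) ⟩
        ℚ.∣ (x m ℚ.- x n) ℚ.+ (y m ℚ.- y n) ∣
          ≤⟨ ℚ.∣p+q∣≤∣p∣+∣q∣ (x m ℚ.- x n) (y m ℚ.- y n) ⟩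
        ℚ.∣ x m ℚ.- x n ∣ ℚ.+ ℚ.∣ y m ℚ.- y n ∣
          <⟨ ℚ.+-mono-<
               (x-close m n (ℕ.m⊔n≤o⇒m≤o N K m≥) (ℕ.m⊔n≤o⇒m≤o N K n≥))
               (y-close m n (ℕ.m⊔n≤o⇒n≤o N K m≥) (ℕ.m⊔n≤o⇒n≤o N K n≥)) ⟩
        ½ ℚ.* ε ℚ.+ ½ ℚ.* ε
          ≡⟨ half+half ε ⟩
        ε ∎
        where open ℚ.≤-Reasoning

    *-cauchy : ∀ x y → IsCauchy x → IsCauchy y → IsCauchy (λ n → x n ℚ.* y n)
    *-cauchy x y x-cauchy y-cauchy ε 0<ε =
      bounded (Cauchy-bound x-cauchy) (Cauchy-bound y-cauchy)
      where
      Goal : Set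
      Goal = CloseBeyond (λ n → x n ℚ.* y n) ε

      bounded : Bounded x → Bounded y → Goal
      bounded (B , B-pos , N₁ , x-bound) (C , C-pos , K₁ , y-bound) =
        tolerated (common-tolerance B C {{B-pos}} {{C-pos}} 0<ε)
        where
        tolerated : ∃[ δ ] (0ℚ ℚ.< δ × B ℚ.* δ ℚ.+ C ℚ.* δ ≡ ε) → Goal
        tolerated (δ , 0<δ , Bδ+Cδ≡ε) = close (x-cauchy δ 0<δ) (y-cauchy δ 0<δ)
          where
          close : CloseBeyond x δ → CloseBeyond y δ → Goal
          close (N₂ , x-close) (K₂ , y-close) =
            (N₁ ℕ.⊔ K₁) ℕ.⊔ (N₂ ℕ.⊔ K₂) , λ m n m≥ n≥ →
            let
              m≥₁ = ℕ.m⊔n≤o⇒m≤o (N₁ ℕ.⊔ K₁) (N₂ ℕ.⊔ K₂) m≥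
              n≥₁ = ℕ.m⊔n≤o⇒m≤o (N₁ ℕ.⊔ K₁) (N₂ ℕ.⊔ K₂) n≥
              m≥₂ = ℕ.m⊔n≤o⇒n≤o (N₁ ℕ.⊔ K₁) (N₂ ℕ.⊔ K₂) m≥
              n≥₂ = ℕ.m⊔n≤o⇒n≤o (N₁ ℕ.⊔ K₁) (N₂ ℕ.⊔ K₂) n≥
            in *-close (x m) (y m) (x n) (y n) {{B-pos}} {{C-pos}}
              (x-bound m (ℕ.m⊔n≤o⇒m≤o N₁ K₁ m≥₁))
              (y-bound n (ℕ.m⊔n≤o⇒n≤o N₁ K₁ n≥₁))
              (x-close m n (ℕ.m⊔n≤o⇒m≤o N₂ K₂ m≥₂) (ℕ.m⊔n≤o⇒m≤o N₂ K₂ n≥₂))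
              (y-close m n (ℕ.m⊔n≤o⇒n≤o N₂ K₂ m≥₂) (ℕ.m⊔n≤o⇒n≤o N₂ K₂ n≥₂))
              Bδ+Cδ≡ε

record ℝ : Set where
  field
    seq    : ℕ → ℚ
    cauchy : IsCauchy seq

open ℝ public

infixl 6 _+_
infixl 7 _*_
infix  4 _≈_ _≤_

_≈_ : ℝ → ℝ → Set
x ≈ y = ∀ ε → 0ℚ ℚ.< ε →
  ∃[ N ] (∀ n → N ℕ.≤ n → ℚ.∣ seq x n ℚ.- seq y n ∣ ℚ.< ε)

_≤_ : ℝ → ℝ → Set
x ≤ y = ∀ ε → 0ℚ ℚ.< ε →
  ∃[ N ] (∀ n → N ℕ.≤ n → seq x n ℚ.< seq y n ℚ.+ ε)

fromℚ : ℚ → ℝ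
fromℚ q .seq    _     = q
fromℚ q .cauchy ε 0<ε =
  0 , λ _ _ _ _ → subst (λ z → ℚ.∣ z ∣ ℚ.< ε) (sym (ℚ.+-inverseʳ q)) 0<ε

0ℝ 1ℝ : ℝ
0ℝ = fromℚ 0ℚ
1ℝ = fromℚ 1ℚ

_+_ : ℝ → ℝ → ℝ
(x + y) .seq    n = seq x n ℚ.+ seq y n
(x + y) .cauchy   = +-cauchy (seq x) (seq y) (cauchy x) (cauchy y)

_*_ : ℝ → ℝ → ℝ
(x * y) .seq    n = seq x n ℚ.* seq y n
(x * y) .cauchy   = *-cauchy (seq x) (seq y) (cauchy x) (cauchy y)

+-rawMonoid : RawMonoid 0ℓ 0ℓ
+-rawMonoid = record { Carrier = ℝ ; _≈_ = _≈_ ; _∙_ = _+_ ; ε = 0ℝ }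

open import Algebra.Definitions.RawMonoid +-rawMonoid public using (sum)

Matrix : ℕ → ℕ → Set
Matrix m n = Fin m → Fin n → ℝ

infix  4 _≈ᴹ_
infixl 7 _*ᴹ_

_≈ᴹ_ : ∀ {m n} → Matrix m n → Matrix m n → Set
A ≈ᴹ B = ∀ i j → A i j ≈ B i j

_*ᴹ_ : ∀ {l m n} → Matrix l m → Matrix m n → Matrix l n
(A *ᴹ B) i j = sum λ k → A i k * B k j

1ᴹ : ∀ {n} → Matrix n n
1ᴹ i j = if does (i ≟ j) then 1ℝ else 0ℝ

sumᴹ : ∀ {k m n} → Vector (Matrix m n) k → Matrix m n
sumᴹ A i j = sum λ t → A t i j

tr : ∀ {n} → Matrix n n → ℝ
tr A = sum λ i → A i i

record IsPSD {n} (A : Matrix n n) : Set where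
  field
    symmetric    : ∀ i j → A i j ≈ A j i
    semidefinite : ∀ (x : Vector ℝ n) → 0ℝ ≤ sum λ i → sum λ j → x i * A i j * x j

record PSDFactorization (r : ℕ) {m n} (M : Matrix m n) : Set where
  field
    T      : Fin m → Matrix r r
    U      : Fin n → Matrix r r
    T-psd  : ∀ i → IsPSD (T i)
    U-psd  : ∀ j → IsPSD (U j)
    factor : ∀ i j → tr (T i *ᴹ U j) ≈ M i j

record State (r : ℕ) : Set where
  field
    ρ     : Matrix r r
    psd   : IsPSD ρ
    trace : tr ρ ≈ 1ℝ

-- The finite label set Θ is enumerated without repetition by `label`.
record POVM (r : ℕ) : Set where
  field
    size           : ℕ
    label          : Fin size → ℝ
    label-distinct : Injective _≡_ _≈_ label
    E              : Fin size → Matrix r r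
    psd            : ∀ t → IsPSD (E t)
    complete       : sumᴹ E ≈ᴹ 1ᴹ

expectation : ∀ {r} → POVM r → State r → ℝ
expectation P S = sum λ t → P.label t * tr (P.E t *ᴹ S.ρ)
  where
  module P = POVM P
  module S = State S

record Protocol (r m n : ℕ) : Set where
  field
    state       : Fin m → State r
    measurement : Fin n → POVM r
    nonnegative : ∀ j t → 0ℝ ≤ POVM.label (measurement j) t

ComputesInExpectation : ∀ {r m n} → Protocol r m n → Matrix m n → Set
ComputesInExpectation Π M =
  ∀ i j → expectation (measurement j) (state i) ≈ M i j
  where open Protocol Π

{-# OPTIONS --safe #-}
module Submission where

-- (i) Fold the labels into the effects: U^j = Σ_θ θ E^j_θ.
-- (ii) Scale all T_i by one constant 1/c so that their traces are at most 1, and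
-- put the missing trace into an extra dimension on which Bob's only
-- effect with nonzero label vanishes. That effect is U^j divided by κ = r K, where K bounds the
-- entries of U^j, so that κ I - U^j is PSD without any spectral theory; the label
-- c κ undoes both scalings.

open import Defs
open import Algebra.Bundles using (CommutativeSemiring)
open import Algebra.Structures.Biased using (IsCommutativeSemiringˡ)
open import Data.Empty using (⊥; ⊥-elim)
open import Data.Fin.Base using (Fin; zero; suc)
open import Data.Nat.Base as ℕ using (ℕ; zero; suc; NonZero)
import Data.Nat.Properties as ℕ
open import Data.Product.Base using (_×_; _,_; proj₁; proj₂; Σ-syntax; ∃-syntax)
open import Data.Rational.Base as ℚ using (ℚ; 0ℚ; 1ℚ; ½)
import Data.Rational.Properties as ℚ
import Data.Rational.Solver as ℚ
open import Data.Sum.Base using (inj₁; inj₂)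
open import Data.Vec.Functional using (Vector)
open import Level using (0ℓ)
open import Relation.Binary.PropositionalEquality
  using (_≡_; refl; sym; trans; cong; cong₂; subst)

open ℚ.+-*-Solver using (solve; con; _:=_; _:+_; _:*_; _:-_; :-_)

-- Rational estimates that hold from some index on.

Eventually : (ℕ → Set) → Set
Eventually P = ∃[ N ] (∀ n → N ℕ.≤ n → P n)

eventually-map : ∀ {P Q : ℕ → Set} → (∀ n → P n → Q n) → Eventually P → Eventually Q
eventually-map f (N , p) = N , λ n N≤n → f n (p n N≤n)

eventually-map₂ : ∀ {P Q R : ℕ → Set} → (∀ n → P n → Q n → R n) →
  Eventually P → Eventually Q → Eventually R
eventually-map₂ f (N , p) (K , q) = N ℕ.⊔ K , λ n n≥ →
  f n (p n (ℕ.m⊔n≤o⇒m≤o N K n≥)) (q n (ℕ.m⊔n≤o⇒n≤o N K n≥))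

0<* : ∀ {p q} → 0ℚ ℚ.< p → 0ℚ ℚ.< q → 0ℚ ℚ.< p ℚ.* q
0<* {p} {q} 0<p 0<q =
  ℚ.positive⁻¹ (p ℚ.* q) {{ℚ.pos*pos⇒pos p {{ℚ.positive 0<p}} q {{ℚ.positive 0<q}}}}

0<½* : ∀ {ε} → 0ℚ ℚ.< ε → 0ℚ ℚ.< ½ ℚ.* ε
0<½* = 0<* (ℚ.positive⁻¹ ½)

½+½ : ∀ p → ½ ℚ.* p ℚ.+ ½ ℚ.* p ≡ p
½+½ p = trans (sym (ℚ.*-distribʳ-+ p ½ ½)) (ℚ.*-identityˡ p)

reciprocal : ∀ {p} → 0ℚ ℚ.< p → ∃[ q ] (0ℚ ℚ.< q × p ℚ.* q ≡ 1ℚ)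
reciprocal {p} 0<p =
  (ℚ.1/ p) , ℚ.positive⁻¹ (ℚ.1/ p) {{ℚ.1/pos⇒pos p}} , ℚ.*-inverseʳ p
  where
  instance
    p-pos : ℚ.Positive p
    p-pos = ℚ.positive 0<p

    p-nonZero : ℚ.NonZero p
    p-nonZero = ℚ.pos⇒nonZero p

quotient : ∀ {p ε} → 0ℚ ℚ.< p → 0ℚ ℚ.< ε → ∃[ δ ] (0ℚ ℚ.< δ × p ℚ.* δ ≡ ε)
quotient {p} {ε} 0<p 0<ε = divide (reciprocal 0<p)
  where
  divide : ∃[ q ] (0ℚ ℚ.< q × p ℚ.* q ≡ 1ℚ) → ∃[ δ ] (0ℚ ℚ.< δ × p ℚ.* δ ≡ ε)
  divide (q , 0<q , pq≡1) = q ℚ.* ε , 0<* 0<q 0<ε ,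
    trans (sym (ℚ.*-assoc p q ε)) (trans (cong (ℚ._* ε) pq≡1) (ℚ.*-identityˡ ε))

∣a∣<b⇒0<b : ∀ {a b} → ℚ.∣ a ∣ ℚ.< b → 0ℚ ℚ.< b
∣a∣<b⇒0<b {a} = ℚ.≤-<-trans (ℚ.0≤∣p∣ a)

∣a∣<b⇒0<b+a : ∀ {a b} → ℚ.∣ a ∣ ℚ.< b → 0ℚ ℚ.< b ℚ.+ a
∣a∣<b⇒0<b+a {a} {b} a<b with ℚ.∣p∣≡p∨∣p∣≡-p a
... | inj₁ ∣a∣≡a =
  ℚ.+-mono-<-≤ (∣a∣<b⇒0<b {a} a<b) (ℚ.∣p∣≡p⇒0≤p ∣a∣≡a)
... | inj₂ ∣a∣≡-a = subst (ℚ._< b ℚ.+ a) (ℚ.+-inverseˡ a)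
  (ℚ.+-monoˡ-< a (subst (ℚ._< b) ∣a∣≡-a a<b))

∣a∣<b⇒0<b-a : ∀ {a b} → ℚ.∣ a ∣ ℚ.< b → 0ℚ ℚ.< b ℚ.- a
∣a∣<b⇒0<b-a {a} {b} a<b = ∣a∣<b⇒0<b+a (subst (ℚ._< b) (sym (ℚ.∣-p∣≡∣p∣ a)) a<b)

∣a*b∣<c*d : ∀ {a b c d} → ℚ.∣ a ∣ ℚ.< c → ℚ.∣ b ∣ ℚ.< d → ℚ.∣ a ℚ.* b ∣ ℚ.< c ℚ.* d
∣a*b∣<c*d {a} {b} {c} {d} a<c b<d = begin-strict
  ℚ.∣ a ℚ.* b ∣        ≡⟨ ℚ.∣p*q∣≡∣p∣*∣q∣ a b ⟩
  ℚ.∣ a ∣ ℚ.* ℚ.∣ b ∣  ≤⟨ ℚ.*-monoʳ-≤-nonNeg ℚ.∣ b ∣ {{ℚ.∣-∣-nonNeg b}} (ℚ.<⇒≤ a<c) ⟩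
  c ℚ.* ℚ.∣ b ∣        <⟨ ℚ.*-monoʳ-<-pos c {{ℚ.positive (∣a∣<b⇒0<b {a} a<c)}} b<d ⟩
  c ℚ.* d              ∎
  where open ℚ.≤-Reasoning

-- All terms from `N` on lie within 1 of `seq x N`. Controlling a tail suffices, since the relations
-- on reals are asymptotic.
bound : ∀ x → ∃[ B ] (0ℚ ℚ.< B × Eventually (λ n → ℚ.∣ seq x n ∣ ℚ.< B))
bound x = from (cauchy x 1ℚ (ℚ.positive⁻¹ 1ℚ))
  where
  from : CloseBeyond (seq x) 1ℚ →
    ∃[ B ] (0ℚ ℚ.< B × Eventually (λ n → ℚ.∣ seq x n ∣ ℚ.< B))
  from (N , close) = B , ∣a∣<b⇒0<b {seq x N} (below N ℕ.≤-refl) , N , below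
    where
    open ℚ.≤-Reasoning

    B : ℚ
    B = 1ℚ ℚ.+ ℚ.∣ seq x N ∣

    below : ∀ n → N ℕ.≤ n → ℚ.∣ seq x n ∣ ℚ.< B
    below n N≤n = begin-strict
      ℚ.∣ seq x n ∣
        ≡⟨ cong ℚ.∣_∣ (solve 2 (λ a b → a := (a :- b) :+ b) refl (seq x n) (seq x N)) ⟩
      ℚ.∣ (seq x n ℚ.- seq x N) ℚ.+ seq x N ∣
        ≤⟨ ℚ.∣p+q∣≤∣p∣+∣q∣ (seq x n ℚ.- seq x N) (seq x N) ⟩
      ℚ.∣ seq x n ℚ.- seq x N ∣ ℚ.+ ℚ.∣ seq x N ∣
        <⟨ ℚ.+-monoˡ-< ℚ.∣ seq x N ∣ (close n N N≤n ℕ.≤-refl) ⟩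
      B ∎

-- Null sequences and the semiring of reals.

-- By definition `x ≈ y` is `Null` of the termwise difference, so the laws of equality become
-- closure properties of null sequences.
Null : (ℕ → ℚ) → Set
Null s = ∀ ε → 0ℚ ℚ.< ε → Eventually (λ n → ℚ.∣ s n ∣ ℚ.< ε)

null-resp : ∀ {s t} → (∀ n → s n ≡ t n) → Null s → Null t
null-resp s≗t s-null ε 0<ε =
  eventually-map (λ n → subst (λ z → ℚ.∣ z ∣ ℚ.< ε) (s≗t n)) (s-null ε 0<ε)

null-0 : Null (λ _ → 0ℚ)
null-0 ε 0<ε = 0 , λ _ _ → 0<ε

null-+ : ∀ {s t} → Null s → Null t → Null (λ n → s n ℚ.+ t n)
null-+ {s} {t} s-null t-null ε 0<ε =
  eventually-map₂ add (s-null (½ ℚ.* ε) (0<½* 0<ε)) (t-null (½ ℚ.* ε) (0<½* 0<ε))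
  where
  open ℚ.≤-Reasoning

  add : ∀ n → ℚ.∣ s n ∣ ℚ.< ½ ℚ.* ε → ℚ.∣ t n ∣ ℚ.< ½ ℚ.* ε → ℚ.∣ s n ℚ.+ t n ∣ ℚ.< ε
  add n s<ε t<ε = begin-strict
    ℚ.∣ s n ℚ.+ t n ∣          ≤⟨ ℚ.∣p+q∣≤∣p∣+∣q∣ (s n) (t n) ⟩
    ℚ.∣ s n ∣ ℚ.+ ℚ.∣ t n ∣    <⟨ ℚ.+-mono-< s<ε t<ε ⟩
    ½ ℚ.* ε ℚ.+ ½ ℚ.* ε        ≡⟨ ½+½ ε ⟩
    ε                          ∎

-- A Cauchy sequence is eventually below some `B`, so tolerance `ε / B` for `s` is enough.
null-* : ∀ x {s} → Null s → Null (λ n → seq x n ℚ.* s n)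
null-* x {s} s-null ε 0<ε = from (bound x)
  where
  Goal : Set
  Goal = Eventually (λ n → ℚ.∣ seq x n ℚ.* s n ∣ ℚ.< ε)

  from : ∃[ B ] (0ℚ ℚ.< B × Eventually (λ n → ℚ.∣ seq x n ∣ ℚ.< B)) → Goal
  from (B , 0<B , x-bound) = tolerated (quotient 0<B 0<ε)
    where
    tolerated : ∃[ δ ] (0ℚ ℚ.< δ × B ℚ.* δ ≡ ε) → Goal
    tolerated (δ , 0<δ , Bδ≡ε) = eventually-map₂
      (λ n x<B s<δ → subst (ℚ.∣ seq x n ℚ.* s n ∣ ℚ.<_) Bδ≡ε
        (∣a*b∣<c*d {seq x n} {s n} x<B s<δ))
      x-bound (s-null δ 0<δ)

-- x ≈ y unfolds to a function type, from which x and y cannot be inferred;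
-- this wrapper keeps them visible.
infix 4 _≃_

record _≃_ (x y : ℝ) : Set where
  constructor wrap
  field unwrap : x ≈ y

open _≃_ public

-- Turns polynomial identities between reals into rational ones at each index, where the ring solver
-- applies.
pointwise : ∀ {x y} → (∀ n → seq x n ≡ seq y n) → x ≃ y
pointwise {x} {y} x≗y .unwrap = null-resp
  (λ n → trans (sym (ℚ.+-inverseʳ (seq y n))) (cong (ℚ._- seq y n) (sym (x≗y n))))
  null-0

≃-refl : ∀ {x} → x ≃ x
≃-refl = pointwise λ _ → refl

≃-sym : ∀ {x y} → x ≃ y → y ≃ x
≃-sym {x} {y} x≃y .unwrap = null-resp
  (λ n → solve 2 (λ a b → con (ℚ.- 1ℚ) :* (a :- b) := b :- a) refl (seq x n) (seq y n))
  (null-* (fromℚ (ℚ.- 1ℚ)) (unwrap x≃y))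

≃-trans : ∀ {x y z} → x ≃ y → y ≃ z → x ≃ z
≃-trans {x} {y} {z} x≃y y≃z .unwrap = null-resp
  (λ n → solve 3 (λ a b c → (a :- b) :+ (b :- c) := a :- c) refl
    (seq x n) (seq y n) (seq z n))
  (null-+ (unwrap x≃y) (unwrap y≃z))

+-cong : ∀ {x y u v} → x ≃ y → u ≃ v → x + u ≃ y + v
+-cong {x} {y} {u} {v} x≃y u≃v .unwrap = null-resp
  (λ n → solve 4 (λ a b c d → (a :- b) :+ (c :- d) := (a :+ c) :- (b :+ d)) refl
    (seq x n) (seq y n) (seq u n) (seq v n))
  (null-+ (unwrap x≃y) (unwrap u≃v))

-- The difference splits as `x (u - v) + v (x - y)`, and each summand is a real times a null
-- sequence.
*-cong : ∀ {x y u v} → x ≃ y → u ≃ v → x * u ≃ y * v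
*-cong {x} {y} {u} {v} x≃y u≃v .unwrap = null-resp
  (λ n → solve 4
    (λ a b c d → a :* (c :- d) :+ d :* (a :- b) := (a :* c) :- (b :* d)) refl
    (seq x n) (seq y n) (seq u n) (seq v n))
  (null-+ (null-* x (unwrap u≃v)) (null-* v (unwrap x≃y)))

-- Gives access to the general lemmas on finite sums: their `sum` and the one in the definitions
-- unfold to the same fold over `_+_` and `0ℝ`.
ℝ-commutativeSemiring : CommutativeSemiring 0ℓ 0ℓ
ℝ-commutativeSemiring = record
  { Carrier = ℝ
  ; _≈_     = _≃_
  ; _+_     = _+_
  ; _*_     = _*_
  ; 0#      = 0ℝ
  ; 1#      = 1ℝ
  ; isCommutativeSemiring = IsCommutativeSemiringˡ.isCommutativeSemiring record
    { +-isCommutativeMonoid = record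
      { isMonoid = record
        { isSemigroup = record
          { isMagma = record { isEquivalence = isEquivalence ; ∙-cong = +-cong }
          ; assoc   = λ x y z → pointwise λ n → ℚ.+-assoc (seq x n) (seq y n) (seq z n)
          }
        ; identity = (λ x → pointwise λ n → ℚ.+-identityˡ (seq x n))
                   , (λ x → pointwise λ n → ℚ.+-identityʳ (seq x n))
        }
      ; comm = λ x y → pointwise λ n → ℚ.+-comm (seq x n) (seq y n)
      }
    ; *-isCommutativeMonoid = record
      { isMonoid = record
        { isSemigroup = record
          { isMagma = record { isEquivalence = isEquivalence ; ∙-cong = *-cong }
          ; assoc   = λ x y z → pointwise λ n → ℚ.*-assoc (seq x n) (seq y n) (seq z n)
          }
        ; identity = (λ x → pointwise λ n → ℚ.*-identityˡ (seq x n))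
                   , (λ x → pointwise λ n → ℚ.*-identityʳ (seq x n))
        }
      ; comm = λ x y → pointwise λ n → ℚ.*-comm (seq x n) (seq y n)
      }
    ; distribʳ = λ x y z → pointwise λ n → ℚ.*-distribʳ-+ (seq x n) (seq y n) (seq z n)
    ; zeroˡ    = λ x → pointwise λ n → ℚ.*-zeroˡ (seq x n)
    }
  }
  where
  open import Relation.Binary.Structures using (IsEquivalence)

  isEquivalence : IsEquivalence _≃_
  isEquivalence = record { refl = ≃-refl ; sym = ≃-sym ; trans = ≃-trans }

-- Nonnegative reals.

infixl 6 _-_

-- The explicit factor `-1` makes this a termwise polynomial; the solver equations below write
-- `con (ℚ.- 1ℚ) :* y` to match it definitionally.
_-_ : ℝ → ℝ → ℝ
x - y = x + fromℚ (ℚ.- 1ℚ) * y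

-- Wrapped for the same reason as `_≃_`: the bare inequality unfolds and hides `x` from inference.
record NonNeg (x : ℝ) : Set where
  constructor wrap
  field unwrap : 0ℝ ≤ x

nonNeg-pointwise : ∀ {x} → (∀ n → 0ℚ ℚ.≤ seq x n) → NonNeg x
nonNeg-pointwise 0≤x .NonNeg.unwrap ε 0<ε = 0 , λ n _ → ℚ.+-mono-≤-< (0≤x n) 0<ε

nonNeg-fromℚ : ∀ {q} → 0ℚ ℚ.≤ q → NonNeg (fromℚ q)
nonNeg-fromℚ 0≤q = nonNeg-pointwise λ _ → 0≤q

nonNeg-0 : NonNeg 0ℝ
nonNeg-0 = nonNeg-fromℚ ℚ.≤-refl

nonNeg-square : ∀ x → NonNeg (x * x)
nonNeg-square x = nonNeg-pointwise λ n → subst (0ℚ ℚ.≤_)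
  (trans (sym (ℚ.∣p*q∣≡∣p∣*∣q∣ (seq x n) (seq x n))) (square (seq x n)))
  (subst (ℚ._≤ ℚ.∣ seq x n ∣ ℚ.* ℚ.∣ seq x n ∣) (ℚ.*-zeroʳ ℚ.∣ seq x n ∣)
    (ℚ.*-monoˡ-≤-nonNeg ℚ.∣ seq x n ∣ {{ℚ.∣-∣-nonNeg (seq x n)}} (ℚ.0≤∣p∣ (seq x n))))
  where
  square : ∀ p → ℚ.∣ p ℚ.* p ∣ ≡ p ℚ.* p
  square p with ℚ.∣p∣≡p∨∣p∣≡-p p
  ... | inj₁ ∣p∣≡p = trans (ℚ.∣p*q∣≡∣p∣*∣q∣ p p) (cong₂ ℚ._*_ ∣p∣≡p ∣p∣≡p)
  ... | inj₂ ∣p∣≡-p = trans (ℚ.∣p*q∣≡∣p∣*∣q∣ p p) (trans (cong₂ ℚ._*_ ∣p∣≡-p ∣p∣≡-p)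
    (solve 1 (λ a → (:- a) :* (:- a) := a :* a) refl p))

nonNeg-resp : ∀ {x y} → x ≃ y → NonNeg x → NonNeg y
nonNeg-resp {x} {y} x≃y 0≤x .NonNeg.unwrap ε 0<ε = eventually-map₂
  -- Adding `ε/2 - (x - y) > 0` and `x + ε/2 > 0` leaves `y + ε > 0`.
  (λ n x~y 0<x → subst (0ℚ ℚ.<_) (regroup n) (ℚ.+-mono-< (∣a∣<b⇒0<b-a x~y) 0<x))
  (unwrap x≃y (½ ℚ.* ε) (0<½* 0<ε)) (NonNeg.unwrap 0≤x (½ ℚ.* ε) (0<½* 0<ε))
  where
  regroup : ∀ n → ((½ ℚ.* ε) ℚ.- (seq x n ℚ.- seq y n)) ℚ.+ (seq x n ℚ.+ ½ ℚ.* ε)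
    ≡ seq y n ℚ.+ ε
  regroup n = solve 3
    (λ a b e → (con ½ :* e :- (a :- b)) :+ (a :+ con ½ :* e) := b :+ e) refl
    (seq x n) (seq y n) ε

nonNeg-+ : ∀ {x y} → NonNeg x → NonNeg y → NonNeg (x + y)
nonNeg-+ {x} {y} 0≤x 0≤y .NonNeg.unwrap ε 0<ε = eventually-map₂
  (λ n 0<x 0<y → subst (0ℚ ℚ.<_) (regroup n) (ℚ.+-mono-< 0<x 0<y))
  (NonNeg.unwrap 0≤x (½ ℚ.* ε) (0<½* 0<ε)) (NonNeg.unwrap 0≤y (½ ℚ.* ε) (0<½* 0<ε))
  where
  regroup : ∀ n → (seq x n ℚ.+ ½ ℚ.* ε) ℚ.+ (seq y n ℚ.+ ½ ℚ.* ε)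
    ≡ (seq x n ℚ.+ seq y n) ℚ.+ ε
  regroup n = solve 3
    (λ a b e → (a :+ con ½ :* e) :+ (b :+ con ½ :* e) := (a :+ b) :+ e) refl
    (seq x n) (seq y n) ε

-- With |x + y + 1| < B and δ = min (1, ε/B), expand (x + δ)(y + δ) > 0 and use
-- δ (x + y + δ) < δ B ≤ ε.
nonNeg-* : ∀ {x y} → NonNeg x → NonNeg y → NonNeg (x * y)
nonNeg-* {x} {y} 0≤x 0≤y .NonNeg.unwrap ε 0<ε = from (bound (x + y + 1ℝ))
  where
  Goal : Set
  Goal = Eventually (λ n → 0ℚ ℚ.< seq x n ℚ.* seq y n ℚ.+ ε)

  from : ∃[ B ] (0ℚ ℚ.< B × Eventually (λ n → ℚ.∣ seq (x + y + 1ℝ) n ∣ ℚ.< B)) → Goal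
  from (B , 0<B , below) = tolerated (quotient 0<B 0<ε)
    where
    tolerated : ∃[ δ ] (0ℚ ℚ.< δ × B ℚ.* δ ≡ ε) → Goal
    tolerated (δ′ , 0<δ′ , Bδ′≡ε) = eventually-map₂
      (λ n (0<x , 0<y) xy<B → conclude (seq x n) (seq y n) 0<x 0<y xy<B)
      (eventually-map₂ (λ _ → _,_) (NonNeg.unwrap 0≤x δ 0<δ) (NonNeg.unwrap 0≤y δ 0<δ))
      below
      where
      open ℚ.≤-Reasoning

      δ : ℚ
      δ = 1ℚ ℚ.⊓ δ′

      0<δ : 0ℚ ℚ.< δ
      0<δ with ℚ.≤-total 1ℚ δ′
      ... | inj₁ 1≤δ′ = subst (0ℚ ℚ.<_) (sym (ℚ.p≤q⇒p⊓q≡p 1≤δ′)) (ℚ.positive⁻¹ 1ℚ)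
      ... | inj₂ δ′≤1 = subst (0ℚ ℚ.<_) (sym (ℚ.p≥q⇒p⊓q≡q δ′≤1)) 0<δ′

      0≤ε-δB : 0ℚ ℚ.≤ ε ℚ.- B ℚ.* δ
      0≤ε-δB = begin
        0ℚ                       ≡⟨ ℚ.+-inverseʳ (B ℚ.* δ) ⟨
        B ℚ.* δ ℚ.- B ℚ.* δ      ≤⟨ ℚ.+-monoˡ-≤ (ℚ.- (B ℚ.* δ)) Bδ≤ε ⟩
        ε ℚ.- B ℚ.* δ            ∎
        where
        Bδ≤ε : B ℚ.* δ ℚ.≤ ε
        Bδ≤ε = subst (B ℚ.* δ ℚ.≤_) Bδ′≡ε
          (ℚ.*-monoˡ-≤-nonNeg B {{ℚ.nonNegative (ℚ.<⇒≤ 0<B)}} (ℚ.p⊓q≤q 1ℚ δ′))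

      0≤1-δ : 0ℚ ℚ.≤ 1ℚ ℚ.- δ
      0≤1-δ = begin
        0ℚ         ≡⟨ ℚ.+-inverseʳ δ ⟨
        δ ℚ.- δ    ≤⟨ ℚ.+-monoˡ-≤ (ℚ.- δ) (ℚ.p⊓q≤p 1ℚ δ′) ⟩
        1ℚ ℚ.- δ   ∎

      conclude : ∀ a b → 0ℚ ℚ.< a ℚ.+ δ → 0ℚ ℚ.< b ℚ.+ δ →
        ℚ.∣ a ℚ.+ b ℚ.+ 1ℚ ∣ ℚ.< B → 0ℚ ℚ.< a ℚ.* b ℚ.+ ε
      conclude a b 0<a+δ 0<b+δ a+b+1<B = subst (0ℚ ℚ.<_)
        (solve 5 (λ a b d B e →
          ((a :+ d) :* (b :+ d) :+ d :* (B :- (a :+ b :+ con 1ℚ)))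
            :+ (d :* (con 1ℚ :- d) :+ (e :- B :* d))
          := a :* b :+ e) refl a b δ B ε)
        (ℚ.+-mono-<-≤
          (ℚ.+-mono-< (0<* 0<a+δ 0<b+δ) (0<* 0<δ (∣a∣<b⇒0<b-a a+b+1<B)))
          (ℚ.+-mono-≤ 0≤δ*[1-δ] 0≤ε-δB))
        where
        0≤δ*[1-δ] : 0ℚ ℚ.≤ δ ℚ.* (1ℚ ℚ.- δ)
        0≤δ*[1-δ] = subst (ℚ._≤ δ ℚ.* (1ℚ ℚ.- δ)) (ℚ.*-zeroʳ δ)
          (ℚ.*-monoˡ-≤-nonNeg δ {{ℚ.nonNegative (ℚ.<⇒≤ 0<δ)}} 0≤1-δ)

-- Rational bounds common to finitely many reals.

Bounds : ℚ → ℝ → Set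
Bounds B x = Eventually (λ n → ℚ.∣ seq x n ∣ ℚ.< B)

bounds-mono : ∀ {B C x} → B ℚ.≤ C → Bounds B x → Bounds C x
bounds-mono B≤C = eventually-map λ _ x<B → ℚ.<-≤-trans x<B B≤C

bounds⇒nonNeg-+ : ∀ {B x} → Bounds B x → NonNeg (fromℚ B + x)
bounds⇒nonNeg-+ {B} {x} x-bound .NonNeg.unwrap ε 0<ε = eventually-map
  (λ n x<B → ℚ.+-mono-< (∣a∣<b⇒0<b+a {seq x n} x<B) 0<ε) x-bound

bounds⇒nonNeg-- : ∀ {B x} → Bounds B x → NonNeg (fromℚ B - x)
bounds⇒nonNeg-- {B} {x} x-bound = bounds⇒nonNeg-+ (eventually-map
  (λ n → subst (ℚ._< B) (trans (sym (ℚ.∣-p∣≡∣p∣ (seq x n)))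
    (cong ℚ.∣_∣ (solve 1 (λ a → :- a := con (ℚ.- 1ℚ) :* a) refl (seq x n)))))
  x-bound)

-- Upward-closed conditions are met together by the maximum of their witnesses; with no conditions
-- the default 1 keeps the result positive. This yields one constant for the traces of all `T i`,
-- and one for all entries of a given `U j`.
uniform : ∀ {n} (P : Fin n → ℚ → Set) → (∀ i {p q} → p ℚ.≤ q → P i p → P i q) →
  (∀ i → ∃[ p ] (0ℚ ℚ.< p × P i p)) → ∃[ p ] (0ℚ ℚ.< p × (∀ i → P i p))
uniform {zero}  P mono witness = 1ℚ , ℚ.positive⁻¹ 1ℚ , λ ()
uniform {suc n} P mono witness = join (witness zero)
  (uniform (λ i → P (suc i)) (λ i → mono (suc i)) (λ i → witness (suc i)))
  where
  join : ∃[ p ] (0ℚ ℚ.< p × P zero p) → ∃[ p ] (0ℚ ℚ.< p × (∀ i → P (suc i) p)) →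
    ∃[ p ] (0ℚ ℚ.< p × (∀ i → P i p))
  join (p , 0<p , Pp) (q , 0<q , Pq) =
    p ℚ.⊔ q , ℚ.<-≤-trans 0<p (ℚ.p≤p⊔q p q) , λ
      { zero    → mono zero (ℚ.p≤p⊔q p q) Pp
      ; (suc i) → mono (suc i) (ℚ.p≤q⊔p p q) (Pq i)
      }

vector-bound : ∀ {n} (x : Vector ℝ n) → ∃[ B ] (0ℚ ℚ.< B × (∀ i → Bounds B (x i)))
vector-bound x = uniform (λ i B → Bounds B (x i)) (λ i → bounds-mono {x = x i}) (λ i → bound (x i))

matrix-bound : ∀ {m n} (A : Matrix m n) →
  ∃[ B ] (0ℚ ℚ.< B × (∀ i j → Bounds B (A i j)))
matrix-bound A = uniform (λ i B → ∀ j → Bounds B (A i j))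
  (λ i B≤C x j → bounds-mono {x = A i j} B≤C (x j)) (λ i → vector-bound (A i))

-- Finite sums and the trace pairing of matrices.

open CommutativeSemiring ℝ-commutativeSemiring
  using (semiring; setoid; +-congˡ; +-congʳ; *-congˡ; *-congʳ; *-comm; *-identityˡ;
         +-identityˡ; +-identityʳ; zeroˡ)
open import Algebra.Properties.Semiring.Sum semiring
  using (*-distribˡ-sum; sum-cong-≋; sum-replicate-zero; ∑-distrib-+; ∑-comm)
import Relation.Binary.Reasoning.Setoid setoid as ≃-Reasoning

fromℚ-cancel : ∀ {p q} → p ℚ.* q ≡ 1ℚ → ∀ x → fromℚ p * (fromℚ q * x) ≃ x
fromℚ-cancel {p} {q} pq≡1 x = pointwise λ n →
  trans (sym (ℚ.*-assoc p q (seq x n)))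
    (trans (cong (ℚ._* seq x n) pq≡1) (ℚ.*-identityˡ (seq x n)))

nonNeg-∑ : ∀ {n} {x : Vector ℝ n} → (∀ i → NonNeg (x i)) → NonNeg (sum x)
nonNeg-∑ {zero}  0≤x = nonNeg-0
nonNeg-∑ {suc n} 0≤x = nonNeg-+ (0≤x zero) (nonNeg-∑ λ i → 0≤x (suc i))

∑-zero : ∀ {n} {x : Vector ℝ n} → (∀ i → x i ≃ 0ℝ) → sum x ≃ 0ℝ
∑-zero {n} x≃0 = ≃-trans (sum-cong-≋ x≃0) (sum-replicate-zero n)

∑∑ : ∀ {m n} → Matrix m n → ℝ
∑∑ A = sum λ i → sum λ j → A i j

∑∑-cong : ∀ {m n} {A B : Matrix m n} → (∀ i j → A i j ≃ B i j) → ∑∑ A ≃ ∑∑ B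
∑∑-cong A≃B = sum-cong-≋ λ i → sum-cong-≋ (A≃B i)

∑∑-+ : ∀ {m n} (A B : Matrix m n) → ∑∑ (λ i j → A i j + B i j) ≃ ∑∑ A + ∑∑ B
∑∑-+ A B = ≃-trans (sum-cong-≋ λ i → ∑-distrib-+ (A i) (B i))
  (∑-distrib-+ (λ i → sum (A i)) (λ i → sum (B i)))

∑∑-* : ∀ {m n} c (A : Matrix m n) → ∑∑ (λ i j → c * A i j) ≃ c * ∑∑ A
∑∑-* c A = ≃-sym (≃-trans (*-distribˡ-sum c λ i → sum (A i))
  (sum-cong-≋ λ i → *-distribˡ-sum c (A i)))

-- The Frobenius inner product. By definition `tr (A *ᴹ B)` is `⟪ A , B ᵀ ⟫`, and the quadratic form
-- of `A` at `x` is `⟪ A , outer x ⟫` up to reordering factors, so traces and forms share one set of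
-- linearity lemmas.
⟪_,_⟫ : ∀ {m n} → Matrix m n → Matrix m n → ℝ
⟪ A , W ⟫ = ∑∑ λ i j → A i j * W i j

infixl 7 _•_
infixl 6 _+ᴹ_ _-ᴹ_
infixr 5 _⊕_

_•_ : ∀ {m n} → ℝ → Matrix m n → Matrix m n
(c • A) i j = c * A i j

_+ᴹ_ _-ᴹ_ : ∀ {m n} → Matrix m n → Matrix m n → Matrix m n
(A +ᴹ B) i j = A i j + B i j
(A -ᴹ B) i j = A i j - B i j

_ᵀ : ∀ {m n} → Matrix m n → Matrix n m
(A ᵀ) i j = A j i

-- The coordinate `zero` is the extra message dimension, decoupled from the others.
_⊕_ : ∀ {m n} → ℝ → Matrix m n → Matrix (suc m) (suc n)
(s ⊕ A) zero    zero    = s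
(s ⊕ A) zero    (suc j) = 0ℝ
(s ⊕ A) (suc i) zero    = 0ℝ
(s ⊕ A) (suc i) (suc j) = A i j

outer : ∀ {n} → Vector ℝ n → Matrix n n
outer x i j = x i * x j

pairing-+ : ∀ {m n} (A B W : Matrix m n) → ⟪ A +ᴹ B , W ⟫ ≃ ⟪ A , W ⟫ + ⟪ B , W ⟫
pairing-+ A B W = ≃-trans
  (∑∑-cong λ i j → pointwise λ n →
    ℚ.*-distribʳ-+ (seq (W i j) n) (seq (A i j) n) (seq (B i j) n))
  (∑∑-+ (λ i j → A i j * W i j) (λ i j → B i j * W i j))

pairing-• : ∀ {m n} c (A W : Matrix m n) → ⟪ c • A , W ⟫ ≃ c * ⟪ A , W ⟫
pairing-• c A W = ≃-trans
  (∑∑-cong λ i j → pointwise λ n →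
    ℚ.*-assoc (seq c n) (seq (A i j) n) (seq (W i j) n))
  (∑∑-* c λ i j → A i j * W i j)

pairing-comm : ∀ {m n} (A W : Matrix m n) → ⟪ A , W ⟫ ≃ ⟪ W , A ⟫
pairing-comm A W = ∑∑-cong λ i j → *-comm (A i j) (W i j)

pairing-sumᴹ : ∀ {k m n} (A : Vector (Matrix m n) k) (W : Matrix m n) →
  ⟪ sumᴹ A , W ⟫ ≃ sum λ t → ⟪ A t , W ⟫
pairing-sumᴹ {zero}  A W = ∑-zero λ i → ∑-zero λ j → zeroˡ (W i j)
pairing-sumᴹ {suc k} A W = ≃-trans (pairing-+ (A zero) (sumᴹ λ t → A (suc t)) W)
  (+-congˡ (pairing-sumᴹ (λ t → A (suc t)) W))

-- The zeros outside the two blocks erase the border of `W`. Used both for quadratic forms and for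
-- outcome probabilities.
pairing-⊕ : ∀ {m n} s (A : Matrix m n) W →
  ⟪ s ⊕ A , W ⟫ ≃ s * W zero zero + ⟪ A , (λ i j → W (suc i) (suc j)) ⟫
pairing-⊕ s A W = +-cong
  (≃-trans (+-congˡ (∑-zero λ j → zeroˡ (W zero (suc j)))) (+-identityʳ (s * W zero zero)))
  (sum-cong-≋ λ i → ≃-trans (+-congʳ (zeroˡ (W (suc i) zero)))
    (+-identityˡ (sum λ j → A i j * W (suc i) (suc j))))

tr-comm : ∀ {m n} (A : Matrix m n) (B : Matrix n m) → tr (A *ᴹ B) ≃ tr (B *ᴹ A)
tr-comm A B = ≃-trans (pairing-comm A (B ᵀ)) (∑-comm λ i j → B j i * A i j)

-- Positive semidefinite matrices.

-- Together with `psd-form`, this passes between the definition of PSD and pairings, so that closure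
-- under sums, scaling and `_⊕_` comes from the pairing lemmas.
psd : ∀ {n} {A : Matrix n n} → (∀ i j → A i j ≃ A j i) →
  (∀ x → NonNeg ⟪ A , outer x ⟫) → IsPSD A
psd {A = A} A-sym A-form = record
  { symmetric    = λ i j → unwrap (A-sym i j)
  ; semidefinite = λ x → NonNeg.unwrap (nonNeg-resp
      (∑∑-cong λ i j → pointwise λ n →
        solve 3 (λ a x y → a :* (x :* y) := x :* a :* y) refl
          (seq (A i j) n) (seq (x i) n) (seq (x j) n))
      (A-form x))
  }

psd-symmetric : ∀ {n} {A : Matrix n n} → IsPSD A → ∀ i j → A i j ≃ A j i
psd-symmetric A-psd i j = wrap (IsPSD.symmetric A-psd i j)

psd-form : ∀ {n} {A : Matrix n n} → IsPSD A → ∀ x → NonNeg ⟪ A , outer x ⟫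
psd-form {A = A} A-psd x = nonNeg-resp
  (∑∑-cong λ i j → pointwise λ n →
    solve 3 (λ a x y → x :* a :* y := a :* (x :* y)) refl
      (seq (A i j) n) (seq (x i) n) (seq (x j) n))
  (wrap (IsPSD.semidefinite A-psd x))

psd-resp : ∀ {n} {A B : Matrix n n} → (∀ i j → A i j ≃ B i j) → IsPSD A → IsPSD B
psd-resp A≃B A-psd = psd
  (λ i j → ≃-trans (≃-sym (A≃B i j)) (≃-trans (psd-symmetric A-psd i j) (A≃B j i)))
  (λ x → nonNeg-resp (∑∑-cong λ i j → *-congʳ (A≃B i j)) (psd-form A-psd x))

psd-+ : ∀ {n} {A B : Matrix n n} → IsPSD A → IsPSD B → IsPSD (A +ᴹ B)
psd-+ {A = A} {B} A-psd B-psd = psd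
  (λ i j → +-cong (psd-symmetric A-psd i j) (psd-symmetric B-psd i j))
  (λ x → nonNeg-resp (≃-sym (pairing-+ A B (outer x)))
    (nonNeg-+ (psd-form A-psd x) (psd-form B-psd x)))

psd-• : ∀ {n c} {A : Matrix n n} → NonNeg c → IsPSD A → IsPSD (c • A)
psd-• {c = c} {A} 0≤c A-psd = psd
  (λ i j → *-congˡ (psd-symmetric A-psd i j))
  (λ x → nonNeg-resp (≃-sym (pairing-• c A (outer x))) (nonNeg-* 0≤c (psd-form A-psd x)))

psd-sumᴹ : ∀ {k n} {A : Vector (Matrix n n) k} → (∀ t → IsPSD (A t)) → IsPSD (sumᴹ A)
psd-sumᴹ {zero}  A-psd = psd (λ _ _ → ≃-refl)
  (λ x → nonNeg-resp (≃-sym (∑-zero λ i → ∑-zero λ j → zeroˡ (x i * x j))) nonNeg-0)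
psd-sumᴹ {suc k} A-psd = psd-+ (A-psd zero) (psd-sumᴹ λ t → A-psd (suc t))

psd-⊕ : ∀ {n s} {A : Matrix n n} → NonNeg s → IsPSD A → IsPSD (s ⊕ A)
psd-⊕ {s = s} {A} 0≤s A-psd = psd
  (λ { zero    zero    → ≃-refl
     ; zero    (suc j) → ≃-refl
     ; (suc i) zero    → ≃-refl
     ; (suc i) (suc j) → psd-symmetric A-psd i j
     })
  (λ x → nonNeg-resp (≃-sym (pairing-⊕ s A (outer x)))
    (nonNeg-+ (nonNeg-* 0≤s (nonNeg-square (x zero))) (psd-form A-psd λ i → x (suc i))))

-- Dominating a symmetric matrix by a multiple of the identity.

-- The recursion works because `1ᴹ (suc i) (suc j)` reduces to `1ᴹ i j`.
1ᴹ-symmetric : ∀ {n} (i j : Fin n) → 1ᴹ i j ≃ 1ᴹ j i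
1ᴹ-symmetric zero    zero    = ≃-refl
1ᴹ-symmetric zero    (suc j) = ≃-refl
1ᴹ-symmetric (suc i) zero    = ≃-refl
1ᴹ-symmetric (suc i) (suc j) = 1ᴹ-symmetric i j

∑-1ᴹ : ∀ {n} (i : Fin n) (x : Vector ℝ n) → sum (λ j → 1ᴹ i j * x j) ≃ x i
∑-1ᴹ zero x = ≃-trans
  (+-cong (*-identityˡ (x zero)) (∑-zero λ j → zeroˡ (x (suc j)))) (+-identityʳ (x zero))
∑-1ᴹ (suc i) x = ≃-trans
  (+-cong (zeroˡ (x zero)) (∑-1ᴹ i λ j → x (suc j))) (+-identityˡ (x (suc i)))

open import Algebra.Definitions.RawMonoid ℚ.+-0-rawMonoid using () renaming (_×_ to _⋆_)

-- Restricted to successors because `zero ⋆ p` is 0. Positivity of the dimension enters here: it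
-- makes the scale `κ` invertible.
0<⋆ : ∀ n {p} → 0ℚ ℚ.< p → 0ℚ ℚ.< suc n ⋆ p
0<⋆ zero    {p} 0<p = subst (0ℚ ℚ.<_) (sym (ℚ.+-identityʳ p)) 0<p
0<⋆ (suc n)     0<p = ℚ.+-mono-< 0<p (0<⋆ n 0<p)

∑-constant : ∀ n p x → sum {n} (λ _ → fromℚ p * x) ≃ fromℚ (n ⋆ p) * x
∑-constant zero    p x = ≃-sym (zeroˡ x)
∑-constant (suc n) p x = ≃-trans (+-congˡ (∑-constant n p x))
  (pointwise λ k → sym (ℚ.*-distribʳ-+ (seq x k) p (n ⋆ p)))

-- For |u| ≤ K, the form K (x² + y²) / 2 - u x y is a nonnegative combination of
-- (x - y)² and (x + y)²; summing over all pairs of coordinates bounds xᵀ U x.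
psd-dominated : ∀ {n K} (U : Matrix n n) → (∀ i j → U i j ≃ U j i) →
  (∀ i j → Bounds K (U i j)) → IsPSD (fromℚ (n ⋆ K) • 1ᴹ -ᴹ U)
psd-dominated {n} {K} U U-sym U-bound = psd
  (λ i j → +-cong (*-congˡ (1ᴹ-symmetric i j)) (*-congˡ (U-sym i j)))
  (λ x → nonNeg-resp (squares≃form x) (nonNeg-∑ λ i → nonNeg-∑ λ j → squares-nonNeg x i j))
  where
  -1ℝ ½K : ℝ
  -1ℝ = fromℚ (ℚ.- 1ℚ)
  ½K  = fromℚ (½ ℚ.* K)

  squares : Vector ℝ n → Matrix n n
  -- The bracket expands to `2 K (x² + y²) - 4 u x y`, hence the factor 1/4.
  squares x i j = fromℚ (½ ℚ.* ½) *
    ((fromℚ K + U i j) * ((x i - x j) * (x i - x j))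
      + (fromℚ K - U i j) * ((x i + x j) * (x i + x j)))

  squares-nonNeg : ∀ x i j → NonNeg (squares x i j)
  squares-nonNeg x i j = nonNeg-* (nonNeg-fromℚ (ℚ.<⇒≤ (ℚ.positive⁻¹ (½ ℚ.* ½))))
    (nonNeg-+
      (nonNeg-* (bounds⇒nonNeg-+ (U-bound i j)) (nonNeg-square (x i - x j)))
      (nonNeg-* (bounds⇒nonNeg-- (U-bound i j)) (nonNeg-square (x i + x j))))

  squares≃form : ∀ x → ∑∑ (squares x) ≃ ⟪ fromℚ (n ⋆ K) • 1ᴹ -ᴹ U , outer x ⟫
  squares≃form x = begin
    ∑∑ (squares x)
      ≈⟨ (∑∑-cong λ i j → pointwise λ k →
           solve 4 (λ K u x y →
             con (½ ℚ.* ½) :*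
               ((K :+ u) :* ((x :+ con (ℚ.- 1ℚ) :* y) :* (x :+ con (ℚ.- 1ℚ) :* y))
                 :+ (K :+ con (ℚ.- 1ℚ) :* u) :* ((x :+ y) :* (x :+ y)))
             := (con ½ :* K :* (x :* x) :+ con ½ :* K :* (y :* y))
               :+ con (ℚ.- 1ℚ) :* u :* (x :* y)) refl
             K (seq (U i j) k) (seq (x i) k) (seq (x j) k)) ⟩
    ∑∑ (λ i j → (rows i j + rows j i) + (-1ℝ • U) i j * outer x i j)
      ≈⟨ ∑∑-+ (λ i j → rows i j + rows j i) (λ i j → (-1ℝ • U) i j * outer x i j) ⟩
    ∑∑ (λ i j → rows i j + rows j i) + ⟪ -1ℝ • U , outer x ⟫
      ≈⟨ +-congʳ (∑∑-+ rows (rows ᵀ)) ⟩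
    (∑∑ rows + ∑∑ (rows ᵀ)) + ⟪ -1ℝ • U , outer x ⟫
      -- A sum over all pairs is invariant under transposition, so the `x i` and `x j` halves
      -- contribute equally.
      ≈⟨ +-congʳ (+-congˡ (∑-comm (rows ᵀ))) ⟩
    (∑∑ rows + ∑∑ rows) + ⟪ -1ℝ • U , outer x ⟫
      ≈⟨ +-congʳ (∑∑-+ rows rows) ⟨
    ∑∑ (λ i j → rows i j + rows i j) + ⟪ -1ℝ • U , outer x ⟫
      ≈⟨ +-congʳ diagonal ⟩
    ⟪ fromℚ (n ⋆ K) • 1ᴹ , outer x ⟫ + ⟪ -1ℝ • U , outer x ⟫
      ≈⟨ pairing-+ (fromℚ (n ⋆ K) • 1ᴹ) (-1ℝ • U) (outer x) ⟨
    ⟪ fromℚ (n ⋆ K) • 1ᴹ -ᴹ U , outer x ⟫ ∎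
    where
    open ≃-Reasoning

    rows : Matrix n n
    rows i j = ½K * (x i * x i)

    diagonal : ∑∑ (λ i j → rows i j + rows i j) ≃ ⟪ fromℚ (n ⋆ K) • 1ᴹ , outer x ⟫
    diagonal = begin
      ∑∑ (λ i j → rows i j + rows i j)
        ≈⟨ (∑∑-cong {n} {n} λ i j → pointwise λ k →
             solve 2 (λ K y → con ½ :* K :* y :+ con ½ :* K :* y := K :* y) refl
               K (seq (x i * x i) k)) ⟩
      ∑∑ {n} {n} (λ i j → fromℚ K * (x i * x i))
        -- The summand is independent of `j`, so each row contributes a factor `n`; this is where
        -- the dimension enters the multiple of the identity.
        ≈⟨ (sum-cong-≋ λ i → ∑-constant n K (x i * x i)) ⟩
      sum (λ i → fromℚ (n ⋆ K) * (x i * x i))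
        ≈⟨ (sum-cong-≋ λ i → ∑-1ᴹ i λ j → fromℚ (n ⋆ K) * (x i * x j)) ⟨
      ∑∑ (λ i j → 1ᴹ i j * (fromℚ (n ⋆ K) * (x i * x j)))
        ≈⟨ (∑∑-cong λ i j → pointwise λ k →
             solve 3 (λ e c y → e :* (c :* y) := c :* e :* y) refl
               (seq (1ᴹ i j) k) (n ⋆ K) (seq (x i * x j) k)) ⟩
      ⟪ fromℚ (n ⋆ K) • 1ᴹ , outer x ⟫ ∎

-- From protocols to factorizations.

protocol⇒factorization : ∀ {m n r} {M : Matrix m n} (Π : Protocol r m n) →
  ComputesInExpectation Π M → PSDFactorization r M
protocol⇒factorization {r = r} {M} Π computes = record
  { T      = λ i → State.ρ (state i)
  ; U      = λ j → sumᴹ (weighted j)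
  ; T-psd  = λ i → State.psd (state i)
  -- Nonnegativity of the labels makes each weighted effect PSD.
  ; U-psd  = λ j → psd-sumᴹ {A = weighted j} λ t →
      psd-• (wrap (nonnegative j t)) (POVM.psd (measurement j) t)
  ; factor = λ i j → unwrap (factor i j)
  }
  where
  open Protocol Π

  weighted : ∀ j → Vector (Matrix r r) (POVM.size (measurement j))
  weighted j t = POVM.label (measurement j) t • POVM.E (measurement j) t

  trace-output : ∀ i j → tr (State.ρ (state i) *ᴹ sumᴹ (weighted j))
    ≃ expectation (measurement j) (state i)
  trace-output i j = begin
    tr (ρ *ᴹ sumᴹ (weighted j))
      ≈⟨ tr-comm ρ (sumᴹ (weighted j)) ⟩
    ⟪ sumᴹ (weighted j) , ρ ᵀ ⟫
      ≈⟨ pairing-sumᴹ (weighted j) (ρ ᵀ) ⟩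
    sum (λ t → ⟪ weighted j t , ρ ᵀ ⟫)
      -- Once the label is pulled out, the remaining pairing with `ρ ᵀ` is by definition the outcome
      -- probability.
      ≈⟨ (sum-cong-≋ λ t →
           pairing-• (POVM.label (measurement j) t) (POVM.E (measurement j) t) (ρ ᵀ)) ⟩
    expectation (measurement j) (state i) ∎
    where
    open ≃-Reasoning
    open State (state i) using (ρ)

  factor : ∀ i j → tr (State.ρ (state i) *ᴹ sumᴹ (weighted j)) ≃ M i j
  factor i j = ≃-trans (trace-output i j) (wrap (computes i j))

-- From factorizations to protocols.

-- The missing trace `1 - ι tr T` equals `ι (c - tr T)`, nonnegative because `c` bounds `tr T`. The
-- scale `ι` is shared by all rows, since Bob's label has to undo it without knowing Alice's input.
scaledState : ∀ {r c ι} → 0ℚ ℚ.< ι → c ℚ.* ι ≡ 1ℚ → (T : Matrix r r) → IsPSD T →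
  Bounds c (tr T) → State (suc r)
scaledState {c = c} {ι} 0<ι cι≡1 T T-psd T-bound = record
  { ρ     = ρ
  ; psd   = psd-⊕ (nonNeg-resp slack (nonNeg-* 0≤ι (bounds⇒nonNeg-- T-bound)))
                  (psd-• 0≤ι T-psd)
  ; trace = unwrap trace
  }
  where
  ρ : Matrix _ _
  ρ = (1ℝ - fromℚ ι * tr T) ⊕ fromℚ ι • T

  trace : tr ρ ≃ 1ℝ
  trace = ≃-trans
    (+-congˡ {1ℝ - fromℚ ι * tr T} (≃-sym (*-distribˡ-sum (fromℚ ι) λ i → T i i)))
    (pointwise λ n → solve 1 (λ t → con 1ℚ :+ con (ℚ.- 1ℚ) :* t :+ t := con 1ℚ) refl
      (seq (fromℚ ι * tr T) n))

  0≤ι : NonNeg (fromℚ ι)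
  0≤ι = nonNeg-fromℚ (ℚ.<⇒≤ 0<ι)

  slack : fromℚ ι * (fromℚ c - tr T) ≃ 1ℝ - fromℚ ι * tr T
  slack = pointwise λ n → trans
    (solve 3 (λ c i t → i :* (c :+ con (ℚ.- 1ℚ) :* t) := c :* i :+ con (ℚ.- 1ℚ) :* (i :* t))
      refl c ι (seq (tr T) n))
    (cong (ℚ._+ ℚ.- 1ℚ ℚ.* (ι ℚ.* seq (tr T) n)) cι≡1)

-- The outcome labelled 0 absorbs the whole extra coordinate, so the padding of the state never
-- affects the expectation. Strict positivity of `ℓ` keeps the two labels distinct.
binaryPOVM : ∀ {r} ℓ → 0ℚ ℚ.< ℓ → (V : Matrix r r) → IsPSD V → IsPSD (1ᴹ -ᴹ V) →
  POVM (suc r)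
binaryPOVM {r} ℓ 0<ℓ V V-psd 1-V-psd = record
  { size           = 2
  ; label          = label
  ; label-distinct = label-distinct
  ; E              = E
  ; psd            = λ
      { zero       → psd-⊕ (nonNeg-fromℚ (ℚ.<⇒≤ (ℚ.positive⁻¹ 1ℚ))) 1-V-psd
      ; (suc zero) → psd-⊕ nonNeg-0 V-psd
      }
  ; complete       = λ a b → unwrap (complete a b)
  }
  where
  label : Vector ℝ 2
  label zero       = 0ℝ
  label (suc zero) = fromℚ ℓ

  E : Vector (Matrix (suc r) (suc r)) 2
  E zero       = 1ℝ ⊕ (1ᴹ -ᴹ V)
  E (suc zero) = 0ℝ ⊕ V

  0≄ℓ : 0ℝ ≃ fromℚ ℓ → ⊥
  -- With tolerance `ℓ` itself, closeness would give `0 < ℓ + (0 - ℓ)`.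
  0≄ℓ 0≃ℓ = absurd (unwrap 0≃ℓ ℓ 0<ℓ)
    where
    absurd : Eventually (λ _ → ℚ.∣ 0ℚ ℚ.- ℓ ∣ ℚ.< ℓ) → ⊥
    absurd (N , close) = ℚ.<-irrefl {0ℚ} (solve 1 (λ l → con 0ℚ := l :+ (con 0ℚ :- l)) refl ℓ)
      (∣a∣<b⇒0<b+a (close N ℕ.≤-refl))

  label-distinct : ∀ {s t} → label s ≈ label t → s ≡ t
  label-distinct {zero}     {zero}     _   = refl
  label-distinct {zero}     {suc zero} 0≈ℓ = ⊥-elim (0≄ℓ (wrap 0≈ℓ))
  label-distinct {suc zero} {zero}     ℓ≈0 = ⊥-elim (0≄ℓ (≃-sym (wrap ℓ≈0)))
  label-distinct {suc zero} {suc zero} _   = refl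

  complete : ∀ a b → sumᴹ E a b ≃ 1ᴹ a b
  complete zero    zero    = pointwise λ _ → refl
  complete zero    (suc b) = pointwise λ _ → refl
  complete (suc a) zero    = pointwise λ _ → refl
  complete (suc a) (suc b) = pointwise λ n →
    solve 2 (λ e v → (e :+ con (ℚ.- 1ℚ) :* v) :+ (v :+ con 0ℚ) := e) refl
      (seq (1ᴹ a b) n) (seq (V a b) n)

-- The order of choices matters: `c` and its inverse `ι` are fixed before any column is considered,
-- while `K`, `κ` and the inverse `μ` of `κ` depend on the column alone.
factorization⇒protocol : ∀ {m n r} {M : Matrix m n} → PSDFactorization (suc r) M →
  Σ[ Π ∈ Protocol (suc (suc r)) m n ] ComputesInExpectation Π M
factorization⇒protocol {m} {n} {r} {M} F = scale (vector-bound λ i → tr (T i))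
  where
  open PSDFactorization F

  Goal : Set
  Goal = Σ[ Π ∈ Protocol (suc (suc r)) m n ] ComputesInExpectation Π M

  scale : ∃[ c ] (0ℚ ℚ.< c × (∀ i → Bounds c (tr (T i)))) → Goal
  scale (c , 0<c , tr-bound) = build (reciprocal 0<c)
    where
    build : ∃[ ι ] (0ℚ ℚ.< ι × c ℚ.* ι ≡ 1ℚ) → Goal
    build (ι , 0<ι , cι≡1) =
      record { state       = alice
             ; measurement = λ j → proj₁ (bob j)
             ; nonnegative = λ j → proj₁ (proj₂ (bob j))
             } , λ i j → unwrap (proj₂ (proj₂ (bob j)) i)
      where
      alice : Fin m → State (suc (suc r))
      alice i = scaledState 0<ι cι≡1 (T i) (T-psd i) (tr-bound i)

      Bob : Fin n → Set
      Bob j = Σ[ P ∈ POVM (suc (suc r)) ]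
        (∀ t → 0ℝ ≤ POVM.label P t) × (∀ i → expectation P (alice i) ≃ M i j)

      bob : ∀ j → Bob j
      bob j = bounded (matrix-bound (U j))
        where
        bounded : ∃[ K ] (0ℚ ℚ.< K × (∀ a b → Bounds K (U j a b))) → Bob j
        bounded (K , 0<K , U-bound) = measure (reciprocal 0<κ)
          where
          κ : ℚ
          κ = suc r ⋆ K

          0<κ : 0ℚ ℚ.< κ
          0<κ = 0<⋆ r 0<K

          measure : ∃[ μ ] (0ℚ ℚ.< μ × κ ℚ.* μ ≡ 1ℚ) → Bob j
          measure (μ , 0<μ , κμ≡1) = P , label-nonNeg , expected
            where
            open ≃-Reasoning

            V : Matrix (suc r) (suc r)
            V = fromℚ μ • U j

            0≤μ : NonNeg (fromℚ μ)
            0≤μ = nonNeg-fromℚ (ℚ.<⇒≤ 0<μ)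

            1-V-psd : IsPSD (1ᴹ -ᴹ V)
            -- Multiplying the PSD matrix `κ I - U j` by `μ` gives `I - V`, because `κ μ = 1`.
            1-V-psd = psd-resp
              (λ a b → pointwise λ k → trans
                (solve 4 (λ κ μ e u →
                  μ :* (κ :* e :+ con (ℚ.- 1ℚ) :* u)
                  := (κ :* μ) :* e :+ con (ℚ.- 1ℚ) :* (μ :* u)) refl
                  κ μ (seq (1ᴹ a b) k) (seq (U j a b) k))
                (cong (ℚ._+ ℚ.- 1ℚ ℚ.* (μ ℚ.* seq (U j a b) k))
                  (trans (cong (ℚ._* seq (1ᴹ a b) k) κμ≡1)
                    (ℚ.*-identityˡ (seq (1ᴹ a b) k)))))
              (psd-• 0≤μ (psd-dominated (U j) (psd-symmetric (U-psd j)) U-bound))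

            0<cκ : 0ℚ ℚ.< c ℚ.* κ
            0<cκ = 0<* 0<c 0<κ

            P : POVM (suc (suc r))
            P = binaryPOVM (c ℚ.* κ) 0<cκ V (psd-• 0≤μ (U-psd j)) 1-V-psd

            label-nonNeg : ∀ t → 0ℝ ≤ POVM.label P t
            label-nonNeg zero       = NonNeg.unwrap nonNeg-0
            label-nonNeg (suc zero) = NonNeg.unwrap (nonNeg-fromℚ (ℚ.<⇒≤ 0<cκ))

            trace-output : ∀ i → tr ((0ℝ ⊕ V) *ᴹ State.ρ (alice i))
              ≃ fromℚ μ * (fromℚ ι * M i j)
            trace-output i = begin
              ⟪ 0ℝ ⊕ V , State.ρ (alice i) ᵀ ⟫
                ≈⟨ pairing-⊕ 0ℝ V (State.ρ (alice i) ᵀ) ⟩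
              0ℝ * State.ρ (alice i) zero zero + ⟪ V , fromℚ ι • (T i ᵀ) ⟫
                -- The zero corner of the effect annihilates the padding of the state.
                ≈⟨ ≃-trans (+-congʳ (zeroˡ (State.ρ (alice i) zero zero)))
                     (+-identityˡ ⟪ V , fromℚ ι • (T i ᵀ) ⟫) ⟩
              ⟪ V , fromℚ ι • (T i ᵀ) ⟫
                ≈⟨ pairing-• (fromℚ μ) (U j) (fromℚ ι • (T i ᵀ)) ⟩
              fromℚ μ * ⟪ U j , fromℚ ι • (T i ᵀ) ⟫
                ≈⟨ *-congˡ (pairing-comm (U j) (fromℚ ι • (T i ᵀ))) ⟩
              fromℚ μ * ⟪ fromℚ ι • (T i ᵀ) , U j ⟫
                ≈⟨ *-congˡ (pairing-• (fromℚ ι) (T i ᵀ) (U j)) ⟩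
              fromℚ μ * (fromℚ ι * tr ((T i ᵀ) *ᴹ (U j ᵀ)))
                -- Interchanging the two sums removes both transposes.
                ≈⟨ *-congˡ (*-congˡ (∑-comm λ a b → T i b a * U j a b)) ⟩
              fromℚ μ * (fromℚ ι * tr (T i *ᴹ U j))
                ≈⟨ *-congˡ (*-congˡ (wrap (factor i j))) ⟩
              fromℚ μ * (fromℚ ι * M i j) ∎

            expected : ∀ i → expectation P (alice i) ≃ M i j
            expected i = begin
              0ℝ * t₀ + (fromℚ (c ℚ.* κ) * t₁ + 0ℝ)
                -- The outcome labelled 0 drops out whatever `t₀` is; the trailing `0ℝ` is the end
                -- of the fold in `sum`.
                ≈⟨ (pointwise λ k →
                     solve 4 (λ c κ s t → con 0ℚ :* s :+ (c :* κ :* t :+ con 0ℚ) := c :* (κ :* t))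
                       refl c κ (seq t₀ k) (seq t₁ k)) ⟩
              fromℚ c * (fromℚ κ * t₁)
                ≈⟨ *-congˡ (*-congˡ (trace-output i)) ⟩
              fromℚ c * (fromℚ κ * (fromℚ μ * (fromℚ ι * M i j)))
                ≈⟨ *-congˡ (fromℚ-cancel κμ≡1 (fromℚ ι * M i j)) ⟩
              fromℚ c * (fromℚ ι * M i j)
                ≈⟨ fromℚ-cancel cι≡1 (M i j) ⟩
              M i j ∎
              where
              t₀ t₁ : ℝ
              t₀ = tr (POVM.E P zero *ᴹ State.ρ (alice i))
              t₁ = tr ((0ℝ ⊕ V) *ᴹ State.ρ (alice i))

theorem14 : ∀ {m n : ℕ} (M : Matrix m n) → (∀ i j → 0ℝ ≤ M i j) →
    (r : ℕ) → .{{_ : NonZero r}} →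
    ((Σ[ Π ∈ Protocol r m n ] ComputesInExpectation Π M) → PSDFactorization r M)
    × (PSDFactorization r M → (Σ[ Π ∈ Protocol (suc r) m n ] ComputesInExpectation Π M))
-- The `NonZero` instance excludes dimension `zero`, leaving the successor that
-- `factorization⇒protocol` expects.
theorem14 M 0≤M (suc r) =
  (λ (Π , computes) → protocol⇒factorization Π computes) , factorization⇒protocol
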